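{- There is a constant $c>0$ such that for every $n\ge 3$, every disk-link drawing of the $n$-vertex star $K_{1,n-1}$ lies on a grid of size $W\times H$ with $W\cdot H\ge c\,n^2$.
   Context: A disk-link drawing of a simple graph maps each vertex to a distinct open disk of radius $\frac12$ and each edge to the straight-line segment connecting the centers of the disks of its endpoints, such that (i) each disk center has integer coordinates, (ii) no two disks intersect, and (iii) no disk is intersected by the segment of a non-incident edge. A drawing is on a grid of size $W\times H$ if the minimum axis-aligned box containing all disk centers has side lengths $W-1$ and $H-1$. -}

module Defs where

open import Data.Nat as ℕ using (ℕ; suc)
open import Data.Integer as ℤ using (ℤ; +_)
open import Data.Rational as ℚ using (ℚ; 0ℚ; 1ℚ)
open import Data.Fin using (Fin; toℕ)
open import Data.Product using (Σ; ∃; ∃-syntax; _×_; _,_)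
open import Data.Sum using (_⊎_)
open import Relation.Nullary using (¬_)
open import Relation.Binary.PropositionalEquality using (_≡_; _≢_)

-- Simple graph on vertex set Fin n: irreflexive symmetric adjacency.
record SimpleGraph (n : ℕ) : Set₁ where
  field
    Adj   : Fin n → Fin n → Set
    irrefl : ∀ v → ¬ Adj v v
    sym   : ∀ {u v} → Adj u v → Adj v u

-- The n-vertex star K_{1,n-1}: vertex 0 is the centre, adjacent to every other vertex.
StarAdj : (n : ℕ) → Fin n → Fin n → Set
StarAdj n u v = (toℕ u ≡ 0 × toℕ v ≢ 0) ⊎ (toℕ v ≡ 0 × toℕ u ≢ 0)

Star : (n : ℕ) → SimpleGraph n
Star n = record { Adj = StarAdj n ; irrefl = irr ; sym = sy }
  where
  open import Data.Sum using (inj₁; inj₂)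
  irr : ∀ v → ¬ StarAdj n v v
  irr v (inj₁ (p , q)) = q p
  irr v (inj₂ (p , q)) = q p
  sy : ∀ {u v} → StarAdj n u v → StarAdj n v u
  sy (inj₁ x) = inj₂ x
  sy (inj₂ x) = inj₁ x

-- Points of the plane: integer points (disk centres) and rational points.
Pointℤ : Set
Pointℤ = ℤ × ℤ

Pointℚ : Set
Pointℚ = ℚ × ℚ

toℚ : ℤ → ℚ
toℚ z = z ℚ./ 1

embed : Pointℤ → Pointℚ
embed (x , y) = toℚ x , toℚ y

dist² : Pointℚ → Pointℚ → ℚ
dist² (x₁ , y₁) (x₂ , y₂) = (x₁ ℚ.- x₂) ℚ.* (x₁ ℚ.- x₂) ℚ.+ (y₁ ℚ.- y₂) ℚ.* (y₁ ℚ.- y₂)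

-- q lies in the open disk of radius 1/2 centred at the integer point c.
InDisk : Pointℤ → Pointℚ → Set
InDisk c q = dist² (embed c) q ℚ.< (+ 1 ℚ./ 4)

-- Two open disks of radius 1/2 intersect.  (Since disks are open, a common
-- real point exists iff a common rational point exists.)
DisksIntersect : Pointℤ → Pointℤ → Set
DisksIntersect c₁ c₂ = ∃[ q ] (InDisk c₁ q × InDisk c₂ q)

-- The point a + t (b - a) on the segment ab.
segPoint : Pointℤ → Pointℤ → ℚ → Pointℚ
segPoint (ax , ay) (bx , by) t =
  (toℚ ax ℚ.+ t ℚ.* (toℚ bx ℚ.- toℚ ax)) , (toℚ ay ℚ.+ t ℚ.* (toℚ by ℚ.- toℚ ay))

-- The closed segment ab meets the open disk of radius 1/2 centred at c.
-- (The intersection is relatively open in the segment, so it is nonempty iff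
-- it contains a point with rational parameter t.)
SegmentHitsDisk : Pointℤ → Pointℤ → Pointℤ → Set
SegmentHitsDisk a b c = ∃[ t ] (0ℚ ℚ.≤ t × t ℚ.≤ 1ℚ × InDisk c (segPoint a b t))

-- Disk-link drawing of G.
record DiskLinkDrawing {n : ℕ} (G : SimpleGraph n) : Set where
  open SimpleGraph G
  field
    pos       : Fin n → Pointℤ
    distinct  : ∀ u v → u ≢ v → pos u ≢ pos v
    disjoint  : ∀ u v → u ≢ v → ¬ DisksIntersect (pos u) (pos v)
    avoid     : ∀ a b v → Adj a b → v ≢ a → v ≢ b → ¬ SegmentHitsDisk (pos a) (pos b) (pos v)

-- f ranges over an interval of length L exactly (min and max attained, difference L).
SideLength : {n : ℕ} → (Fin n → ℤ) → ℕ → Set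
SideLength {n} f L = ∃[ i ] ∃[ j ] ((∀ k → (f i ℤ.≤ f k) × (f k ℤ.≤ f j)) × (f j ℤ.- f i ≡ + L))

xs : {n : ℕ} → (Fin n → Pointℤ) → Fin n → ℤ
xs p k = Data.Product.proj₁ (p k)

ys : {n : ℕ} → (Fin n → Pointℤ) → Fin n → ℤ
ys p k = Data.Product.proj₂ (p k)

-- The drawing is on a W × H grid: the minimum axis-aligned bounding box of the
-- disk centres has side lengths W - 1 and H - 1.
OnGrid : {n : ℕ} {G : SimpleGraph n} → DiskLinkDrawing G → ℕ → ℕ → Set
OnGrid D W H = ∃[ Lx ] ∃[ Ly ]
  (W ≡ suc Lx × H ≡ suc Ly × SideLength (xs (DiskLinkDrawing.pos D)) Lx
                            × SideLength (ys (DiskLinkDrawing.pos D)) Ly)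

-- Put the centre of the star at the origin. If two leaves u, w lie in the same closed quadrant
-- and ‖u‖ ≤ ‖w‖, then 0 ≤ ⟨u, w⟩ ≤ ‖w‖², so the foot of the perpendicular from u to the edge 0w
-- lies on that edge, at distance |u × w| / ‖w‖; as the disk of u avoids the edge,
-- ‖w‖² ≤ 4 (u × w)². So the leaves of one quadrant are far from parallel at their own scale.
-- Sort them into dyadic shells 2 ^ j ≤ ‖u‖₁ < 2 ^ (j + 1) and, inside a shell, by slope into
-- 12 min(2 ^ j, m) + 1 sectors, m the shorter side of the bounding box: two leaves of one
-- quadrant, shell and sector would be too close to parallel. Summing over the shells up to
-- 2 ^ J ≈ W + H gives n = O(√(m 2 ^ J)), that is n² = O(m (W + H)) = O(W H).

module Submission where

open import Defs
open import Data.Nat as ℕ using (ℕ; zero; suc; _+_; _*_; _^_; _⊓_; _≤_; _<_; z≤n; s≤s; NonZero)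
open import Data.Nat.DivMod using (_/_; _%_; m≡m%n+[m/n]*n; m%n<n; m<n*o⇒m/o<n)
open import Data.Nat.Tactic.RingSolver using (solve-∀)
import Data.Nat.Properties as ℕ
open import Data.Integer as ℤ using (ℤ; +_)
import Data.Integer.Properties as ℤ
open import Data.Rational as ℚ using (ℚ; 0ℚ; 1ℚ)
import Data.Rational.Properties as ℚ
import Data.Rational.Unnormalised as ℚᵘ
import Data.Rational.Unnormalised.Properties as ℚᵘ
import Data.Rational.Solver as ℚ-Solver
open import Function using (_∘_)
open import Data.Product using (Σ; _×_; _,_; proj₁; proj₂; swap; ∃-syntax)
open import Data.Sum using (inj₁; inj₂; [_,_]′)
open import Data.Fin as Fin using (Fin)
import Data.Fin.Properties as Fin
open import Data.Sign as Sign using (Sign)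
import Data.Sign.Properties as Sign
open import Relation.Binary.PropositionalEquality
open import Relation.Binary.Definitions using (tri<; tri≈; tri>)
open import Relation.Nullary using (yes; no; contradiction)
open import Relation.Nullary.Decidable using (decidable-stable)
open import Data.Empty using (⊥)

-- Integers inside ℚ

private
  toℚᵘ-toℚ : ∀ z → ℚ.toℚᵘ (toℚ z) ℚᵘ.≃ ℚᵘ.mkℚᵘ z 0
  toℚᵘ-toℚ z = ℚ.toℚᵘ-fromℚᵘ (ℚᵘ.mkℚᵘ z 0)

toℚ-+ : ∀ a b → toℚ (a ℤ.+ b) ≡ toℚ a ℚ.+ toℚ b
toℚ-+ a b = ℚ.toℚᵘ-injective (ℚᵘ.≃-trans (toℚᵘ-toℚ (a ℤ.+ b)) (ℚᵘ.≃-sym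
  (ℚᵘ.≃-trans (ℚ.toℚᵘ-homo-+ (toℚ a) (toℚ b))
  (ℚᵘ.≃-trans (ℚᵘ.+-cong (toℚᵘ-toℚ a) (toℚᵘ-toℚ b)) (ℚᵘ.*≡* eq)))))
  where
  eq : (a ℤ.* + 1 ℤ.+ b ℤ.* + 1) ℤ.* + 1 ≡ (a ℤ.+ b) ℤ.* + 1
  eq rewrite ℤ.*-identityʳ a | ℤ.*-identityʳ b = refl

toℚ-* : ∀ a b → toℚ (a ℤ.* b) ≡ toℚ a ℚ.* toℚ b
toℚ-* a b = ℚ.toℚᵘ-injective (ℚᵘ.≃-trans (toℚᵘ-toℚ (a ℤ.* b)) (ℚᵘ.≃-sym
  (ℚᵘ.≃-trans (ℚ.toℚᵘ-homo-* (toℚ a) (toℚ b)) (ℚᵘ.*-cong (toℚᵘ-toℚ a) (toℚᵘ-toℚ b)))))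

toℚ-neg : ∀ a → toℚ (ℤ.- a) ≡ ℚ.- toℚ a
toℚ-neg a = ℚ.toℚᵘ-injective (ℚᵘ.≃-trans (toℚᵘ-toℚ (ℤ.- a)) (ℚᵘ.≃-sym
  (ℚᵘ.≃-trans (ℚ.toℚᵘ-homo‿- (toℚ a)) (ℚᵘ.-‿cong (toℚᵘ-toℚ a)))))

toℚ-- : ∀ a b → toℚ (a ℤ.- b) ≡ toℚ a ℚ.- toℚ b
toℚ-- a b = trans (toℚ-+ a (ℤ.- b)) (cong (toℚ a ℚ.+_) (toℚ-neg b))

toℚ-mono-≤ : ∀ {a b} → a ℤ.≤ b → toℚ a ℚ.≤ toℚ b
toℚ-mono-≤ {a} {b} a≤b = ℚ.toℚᵘ-cancel-≤
  (ℚᵘ.≤-respʳ-≃ (ℚᵘ.≃-sym (toℚᵘ-toℚ b)) (ℚᵘ.≤-respˡ-≃ (ℚᵘ.≃-sym (toℚᵘ-toℚ a))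
    (ℚᵘ.*≤* (subst₂ ℤ._≤_ (sym (ℤ.*-identityʳ a)) (sym (ℤ.*-identityʳ b)) a≤b))))

toℚ-mono-< : ∀ {a b} → a ℤ.< b → toℚ a ℚ.< toℚ b
toℚ-mono-< {a} {b} a<b = ℚ.toℚᵘ-cancel-<
  (ℚᵘ.<-respʳ-≃ (ℚᵘ.≃-sym (toℚᵘ-toℚ b)) (ℚᵘ.<-respˡ-≃ (ℚᵘ.≃-sym (toℚᵘ-toℚ a))
    (ℚᵘ.*<* (subst₂ ℤ._<_ (sym (ℤ.*-identityʳ a)) (sym (ℤ.*-identityʳ b)) a<b))))

/-*-toℚ : ∀ a n .{{_ : NonZero n}} → (a ℚ./ n) ℚ.* toℚ (+ n) ≡ toℚ a
/-*-toℚ a (suc k) = ℚ.toℚᵘ-injective (ℚᵘ.≃-trans (ℚ.toℚᵘ-homo-* (a ℚ./ suc k) (toℚ (+ suc k)))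
  (ℚᵘ.≃-trans (ℚᵘ.*-cong (ℚ.toℚᵘ-fromℚᵘ (ℚᵘ.mkℚᵘ a k)) (toℚᵘ-toℚ (+ suc k)))
  (ℚᵘ.≃-trans (ℚᵘ.*≡* eq) (ℚᵘ.≃-sym (toℚᵘ-toℚ a)))))
  where
  eq : (a ℤ.* + suc k) ℤ.* + 1 ≡ a ℤ.* + suc (k * 1)
  eq rewrite ℕ.*-identityʳ k = ℤ.*-identityʳ (a ℤ.* + suc k)

-- Distance from a point to a segment

infixl 6 _-ᵖ_ _-ᵠ_ _+ᵠ_
infixl 7 _·ᵠ_

_-ᵖ_ : Pointℤ → Pointℤ → Pointℤ
(x , y) -ᵖ (x′ , y′) = x ℤ.- x′ , y ℤ.- y′

dot cross : Pointℤ → Pointℤ → ℤ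
dot (x , y) (x′ , y′) = x ℤ.* x′ ℤ.+ y ℤ.* y′
cross (x , y) (x′ , y′) = x ℤ.* y′ ℤ.- y ℤ.* x′

_-ᵠ_ _+ᵠ_ : Pointℚ → Pointℚ → Pointℚ
(x , y) -ᵠ (x′ , y′) = x ℚ.- x′ , y ℚ.- y′
(x , y) +ᵠ (x′ , y′) = x ℚ.+ x′ , y ℚ.+ y′

_·ᵠ_ : ℚ → Pointℚ → Pointℚ
t ·ᵠ (x , y) = t ℚ.* x , t ℚ.* y

dotᵠ crossᵠ : Pointℚ → Pointℚ → ℚ
dotᵠ (x , y) (x′ , y′) = x ℚ.* x′ ℚ.+ y ℚ.* y′
crossᵠ (x , y) (x′ , y′) = x ℚ.* y′ ℚ.- y ℚ.* x′

embed-sub : ∀ p q → embed (p -ᵖ q) ≡ embed p -ᵠ embed q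
embed-sub (x , y) (x′ , y′) = cong₂ _,_ (toℚ-- x x′) (toℚ-- y y′)

toℚ-dot : ∀ p q → toℚ (dot p q) ≡ dotᵠ (embed p) (embed q)
toℚ-dot (x , y) (x′ , y′) =
  trans (toℚ-+ (x ℤ.* x′) (y ℤ.* y′)) (cong₂ ℚ._+_ (toℚ-* x x′) (toℚ-* y y′))

toℚ-cross : ∀ p q → toℚ (cross p q) ≡ crossᵠ (embed p) (embed q)
toℚ-cross (x , y) (x′ , y′) =
  trans (toℚ-- (x ℤ.* y′) (y ℤ.* x′)) (cong₂ ℚ._-_ (toℚ-* x y′) (toℚ-* y x′))

-- The hypothesis says that a + t(b − a) is the foot of the perpendicular from c to the line ab;
-- the identity is then Lagrange's identity ‖u‖²‖w‖² − ⟨u, w⟩² = (u × w)².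
foot-of-perpendicular : ∀ (a b c : Pointℚ) t →
  t ℚ.* dotᵠ (b -ᵠ a) (b -ᵠ a) ≡ dotᵠ (c -ᵠ a) (b -ᵠ a) →
  dist² c (a +ᵠ t ·ᵠ (b -ᵠ a)) ℚ.* dotᵠ (b -ᵠ a) (b -ᵠ a)
    ≡ crossᵠ (c -ᵠ a) (b -ᵠ a) ℚ.* crossᵠ (c -ᵠ a) (b -ᵠ a)
foot-of-perpendicular a@(ax , ay) b@(bx , by) c@(cx , cy) t tN≡D = begin
  dist² c (a +ᵠ t ·ᵠ w) ℚ.* N        ≡⟨ expand ⟩
  dotᵠ u u ℚ.* N ℚ.- two ℚ.* (t ℚ.* N) ℚ.* D ℚ.+ (t ℚ.* N) ℚ.* (t ℚ.* N)
                                      ≡⟨ cong (λ T → dotᵠ u u ℚ.* N ℚ.- two ℚ.* T ℚ.* D ℚ.+ T ℚ.* T) tN≡D ⟩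
  dotᵠ u u ℚ.* N ℚ.- two ℚ.* D ℚ.* D ℚ.+ D ℚ.* D
                                      ≡⟨ lagrange (cx ℚ.- ax) (cy ℚ.- ay) (bx ℚ.- ax) (by ℚ.- ay) ⟩
  crossᵠ u w ℚ.* crossᵠ u w           ∎
  where
  open ≡-Reasoning
  open ℚ-Solver.+-*-Solver
  u w : Pointℚ
  u = c -ᵠ a
  w = b -ᵠ a
  N D two : ℚ
  N = dotᵠ w w
  D = dotᵠ u w
  two = + 2 ℚ./ 1
  expand : dist² c (a +ᵠ t ·ᵠ w) ℚ.* N
           ≡ dotᵠ u u ℚ.* N ℚ.- two ℚ.* (t ℚ.* N) ℚ.* D ℚ.+ (t ℚ.* N) ℚ.* (t ℚ.* N)
  expand = solve 7 (λ ax ay bx by cx cy t →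
    let ux = cx :- ax ; uy = cy :- ay ; wx = bx :- ax ; wy = by :- ay
        N = wx :* wx :+ wy :* wy ; D = ux :* wx :+ uy :* wy in
    ((cx :- (ax :+ t :* wx)) :* (cx :- (ax :+ t :* wx)) :+ (cy :- (ay :+ t :* wy)) :* (cy :- (ay :+ t :* wy))) :* N
    := (ux :* ux :+ uy :* uy) :* N :- con two :* (t :* N) :* D :+ (t :* N) :* (t :* N)) refl
    ax ay bx by cx cy t
  lagrange : ∀ ux uy wx wy →
    (ux ℚ.* ux ℚ.+ uy ℚ.* uy) ℚ.* (wx ℚ.* wx ℚ.+ wy ℚ.* wy)
      ℚ.- two ℚ.* (ux ℚ.* wx ℚ.+ uy ℚ.* wy) ℚ.* (ux ℚ.* wx ℚ.+ uy ℚ.* wy)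
      ℚ.+ (ux ℚ.* wx ℚ.+ uy ℚ.* wy) ℚ.* (ux ℚ.* wx ℚ.+ uy ℚ.* wy)
    ≡ (ux ℚ.* wy ℚ.- uy ℚ.* wx) ℚ.* (ux ℚ.* wy ℚ.- uy ℚ.* wx)
  lagrange = solve 4 (λ ux uy wx wy →
    (ux :* ux :+ uy :* uy) :* (wx :* wx :+ wy :* wy)
      :- con two :* (ux :* wx :+ uy :* wy) :* (ux :* wx :+ uy :* wy)
      :+ (ux :* wx :+ uy :* wy) :* (ux :* wx :+ uy :* wy)
    := (ux :* wy :- uy :* wx) :* (ux :* wy :- uy :* wx)) refl

toℚ-dot-sub : ∀ p q r → toℚ (dot (p -ᵖ r) (q -ᵖ r)) ≡ dotᵠ (embed p -ᵠ embed r) (embed q -ᵠ embed r)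
toℚ-dot-sub p q r = trans (toℚ-dot (p -ᵖ r) (q -ᵖ r)) (cong₂ dotᵠ (embed-sub p r) (embed-sub q r))

toℚ-cross-sub : ∀ p q r → toℚ (cross (p -ᵖ r) (q -ᵖ r)) ≡ crossᵠ (embed p -ᵠ embed r) (embed q -ᵠ embed r)
toℚ-cross-sub p q r = trans (toℚ-cross (p -ᵖ r) (q -ᵖ r)) (cong₂ crossᵠ (embed-sub p r) (embed-sub q r))

-- The witness is the foot of the perpendicular from c, at parameter t = ⟨c − a, b − a⟩ / ‖b − a‖².
segment-hits-disk : ∀ a b c {d N} .{{_ : NonZero N}} →
  dot (c -ᵖ a) (b -ᵖ a) ≡ + d → dot (b -ᵖ a) (b -ᵖ a) ≡ + N → d ≤ N →
  + 4 ℤ.* (cross (c -ᵖ a) (b -ᵖ a) ℤ.* cross (c -ᵖ a) (b -ᵖ a)) ℤ.< + N →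
  SegmentHitsDisk a b c
segment-hits-disk a b c {d} {N} D≡d ‖b-a‖²≡N d≤N 4κ²<N = t , 0≤t , t≤1 , c-near-foot
  where
  open ≡-Reasoning
  κ : ℤ
  κ = cross (c -ᵖ a) (b -ᵖ a)
  t Nᵠ κ²ᵠ ¼ : ℚ
  t = + d ℚ./ N
  Nᵠ = toℚ (+ N)
  κ²ᵠ = toℚ (κ ℤ.* κ)
  ¼ = + 1 ℚ./ 4
  A B C : Pointℚ
  A = embed a
  B = embed b
  C = embed c
  Nᵠ≡‖B-A‖² : Nᵠ ≡ dotᵠ (B -ᵠ A) (B -ᵠ A)
  Nᵠ≡‖B-A‖² = trans (cong toℚ (sym ‖b-a‖²≡N)) (toℚ-dot-sub b b a)
  t-projects : t ℚ.* dotᵠ (B -ᵠ A) (B -ᵠ A) ≡ dotᵠ (C -ᵠ A) (B -ᵠ A)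
  t-projects = begin
    t ℚ.* dotᵠ (B -ᵠ A) (B -ᵠ A) ≡⟨ cong (t ℚ.*_) Nᵠ≡‖B-A‖² ⟨
    t ℚ.* Nᵠ                     ≡⟨ /-*-toℚ (+ d) N ⟩
    toℚ (+ d)                    ≡⟨ cong toℚ D≡d ⟨
    toℚ (dot (c -ᵖ a) (b -ᵖ a))  ≡⟨ toℚ-dot-sub c b a ⟩
    dotᵠ (C -ᵠ A) (B -ᵠ A)       ∎
  dist²·N≡κ² : dist² C (segPoint a b t) ℚ.* Nᵠ ≡ κ²ᵠ
  dist²·N≡κ² = begin
    dist² C (segPoint a b t) ℚ.* Nᵠ                       ≡⟨ cong (dist² C (segPoint a b t) ℚ.*_) Nᵠ≡‖B-A‖² ⟩
    dist² C (segPoint a b t) ℚ.* dotᵠ (B -ᵠ A) (B -ᵠ A)   ≡⟨ foot-of-perpendicular A B C t t-projects ⟩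
    crossᵠ (C -ᵠ A) (B -ᵠ A) ℚ.* crossᵠ (C -ᵠ A) (B -ᵠ A) ≡⟨ cong₂ ℚ._*_ (toℚ-cross-sub c b a) (toℚ-cross-sub c b a) ⟨
    toℚ κ ℚ.* toℚ κ                                       ≡⟨ toℚ-* κ κ ⟨
    κ²ᵠ                                                   ∎
  4*¼N≡N : toℚ (+ 4) ℚ.* (¼ ℚ.* Nᵠ) ≡ Nᵠ
  4*¼N≡N = trans (sym (ℚ.*-assoc (toℚ (+ 4)) ¼ Nᵠ)) (ℚ.*-identityˡ Nᵠ)
  κ²<¼N : κ²ᵠ ℚ.< ¼ ℚ.* Nᵠ
  κ²<¼N = ℚ.*-cancelˡ-<-nonNeg (toℚ (+ 4)) {{ℚ.normalize-nonNeg 4 1}}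
    (subst₂ ℚ._<_ (toℚ-* (+ 4) (κ ℤ.* κ)) (sym 4*¼N≡N) (toℚ-mono-< 4κ²<N))
  c-near-foot : InDisk c (segPoint a b t)
  c-near-foot = ℚ.*-cancelʳ-<-nonNeg Nᵠ {{ℚ.normalize-nonNeg N 1}}
    (subst (ℚ._< ¼ ℚ.* Nᵠ) (sym dist²·N≡κ²) κ²<¼N)
  0≤t : 0ℚ ℚ.≤ t
  0≤t = ℚ.nonNegative⁻¹ t {{ℚ.normalize-nonNeg d N}}
  t≤1 : t ℚ.≤ 1ℚ
  t≤1 = ℚ.*-cancelʳ-≤-pos Nᵠ {{ℚ.normalize-pos N 1}}
    (subst₂ ℚ._≤_ (sym (/-*-toℚ (+ d) N)) (sym (ℚ.*-identityˡ Nᵠ)) (toℚ-mono-≤ (ℤ.+≤+ d≤N)))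

-- Vectors of one quadrant as vectors in ℕ²

infixl 7 _·ℕ_ _×ℕ_

_·ℕ_ _×ℕ_ : ℕ × ℕ → ℕ × ℕ → ℕ
(a , b) ·ℕ (a′ , b′) = a * a′ + b * b′
(a , b) ×ℕ (a′ , b′) = ℕ.∣ a * b′ - b * a′ ∣

∣_∣ᵖ : Pointℤ → ℕ × ℕ
∣ x , y ∣ᵖ = ℤ.∣ x ∣ , ℤ.∣ y ∣

SameQuadrant : Pointℤ → Pointℤ → Set
SameQuadrant (x , y) (x′ , y′) = ℤ.sign x ≡ ℤ.sign x′ × ℤ.sign y ≡ ℤ.sign y′

signIndex : Sign → Fin 2
signIndex Sign.+ = Fin.zero
signIndex Sign.- = Fin.suc Fin.zero

signIndex-injective : ∀ {s t} → signIndex s ≡ signIndex t → s ≡ t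
signIndex-injective {Sign.+} {Sign.+} _ = refl
signIndex-injective {Sign.-} {Sign.-} _ = refl

quadrant : Pointℤ → Fin 4
quadrant (x , y) = Fin.combine (signIndex (ℤ.sign x)) (signIndex (ℤ.sign y))

quadrant≡⇒SameQuadrant : ∀ p q → quadrant p ≡ quadrant q → SameQuadrant p q
quadrant≡⇒SameQuadrant (x , y) (x′ , y′) eq =
  let sx , sy = Fin.combine-injective (signIndex (ℤ.sign x)) (signIndex (ℤ.sign y)) (signIndex (ℤ.sign x′)) (signIndex (ℤ.sign y′)) eq
  in signIndex-injective sx , signIndex-injective sy

sameSign⇒*≡+∣*∣ : ∀ {i j} → ℤ.sign i ≡ ℤ.sign j → i ℤ.* j ≡ + (ℤ.∣ i ∣ * ℤ.∣ j ∣)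
sameSign⇒*≡+∣*∣ {i} {j} eq = begin
  (ℤ.sign i Sign.* ℤ.sign j) ℤ.◃ ℤ.∣ i ∣ * ℤ.∣ j ∣ ≡⟨ cong (λ s → (ℤ.sign i Sign.* s) ℤ.◃ ℤ.∣ i ∣ * ℤ.∣ j ∣) eq ⟨
  (ℤ.sign i Sign.* ℤ.sign i) ℤ.◃ ℤ.∣ i ∣ * ℤ.∣ j ∣ ≡⟨ cong (ℤ._◃ ℤ.∣ i ∣ * ℤ.∣ j ∣) (Sign.s*s≡+ (ℤ.sign i)) ⟩
  Sign.+ ℤ.◃ ℤ.∣ i ∣ * ℤ.∣ j ∣                     ≡⟨ ℤ.+◃n≡+n (ℤ.∣ i ∣ * ℤ.∣ j ∣) ⟩
  + (ℤ.∣ i ∣ * ℤ.∣ j ∣)                            ∎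
  where open ≡-Reasoning

i*i≡+∣i∣*∣i∣ : ∀ i → i ℤ.* i ≡ + (ℤ.∣ i ∣ * ℤ.∣ i ∣)
i*i≡+∣i∣*∣i∣ i = sameSign⇒*≡+∣*∣ {i} refl

∣m⊖n∣≡∣m-n∣ : ∀ m n → ℤ.∣ m ℤ.⊖ n ∣ ≡ ℕ.∣ m - n ∣
∣m⊖n∣≡∣m-n∣ m n with ℕ.≤-total m n
... | inj₁ m≤n = trans (ℤ.∣⊖∣-≤ m≤n) (sym (ℕ.m≤n⇒∣m-n∣≡n∸m m≤n))
... | inj₂ n≤m = trans (ℤ.∣m⊖n∣≡∣n⊖m∣ m n) (trans (ℤ.∣⊖∣-≤ n≤m) (sym (ℕ.m≤n⇒∣n-m∣≡n∸m n≤m)))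

∣s◃m-s◃n∣≡∣m-n∣ : ∀ s m n → ℤ.∣ (s ℤ.◃ m) ℤ.- (s ℤ.◃ n) ∣ ≡ ℕ.∣ m - n ∣
∣s◃m-s◃n∣≡∣m-n∣ Sign.+ m n = begin
  ℤ.∣ (Sign.+ ℤ.◃ m) ℤ.- (Sign.+ ℤ.◃ n) ∣ ≡⟨ cong₂ (λ i j → ℤ.∣ i ℤ.- j ∣) (ℤ.+◃n≡+n m) (ℤ.+◃n≡+n n) ⟩
  ℤ.∣ + m ℤ.- + n ∣                   ≡⟨ cong ℤ.∣_∣ (ℤ.m-n≡m⊖n m n) ⟩
  ℤ.∣ m ℤ.⊖ n ∣                       ≡⟨ ∣m⊖n∣≡∣m-n∣ m n ⟩
  ℕ.∣ m - n ∣                         ∎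
  where open ≡-Reasoning
∣s◃m-s◃n∣≡∣m-n∣ Sign.- m n = begin
  ℤ.∣ (Sign.- ℤ.◃ m) ℤ.- (Sign.- ℤ.◃ n) ∣ ≡⟨ cong₂ (λ i j → ℤ.∣ i ℤ.- j ∣) (ℤ.-◃n≡-n m) (ℤ.-◃n≡-n n) ⟩
  ℤ.∣ ℤ.- + m ℤ.- ℤ.- + n ∣           ≡⟨ cong ℤ.∣_∣ (ℤ.neg-distrib-+ (+ m) (ℤ.- + n)) ⟨
  ℤ.∣ ℤ.- (+ m ℤ.- + n) ∣             ≡⟨ ℤ.∣-i∣≡∣i∣ (+ m ℤ.- + n) ⟩
  ℤ.∣ + m ℤ.- + n ∣                   ≡⟨ cong ℤ.∣_∣ (ℤ.m-n≡m⊖n m n) ⟩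
  ℤ.∣ m ℤ.⊖ n ∣                       ≡⟨ ∣m⊖n∣≡∣m-n∣ m n ⟩
  ℕ.∣ m - n ∣                         ∎
  where open ≡-Reasoning

dot≡+·ℕ : ∀ p q → SameQuadrant p q → dot p q ≡ + (∣ p ∣ᵖ ·ℕ ∣ q ∣ᵖ)
dot≡+·ℕ (x , y) (x′ , y′) (sx , sy) =
  trans (cong₂ ℤ._+_ (sameSign⇒*≡+∣*∣ sx) (sameSign⇒*≡+∣*∣ sy)) (sym (ℤ.pos-+ (ℤ.∣ x ∣ * ℤ.∣ x′ ∣) (ℤ.∣ y ∣ * ℤ.∣ y′ ∣)))

∣cross∣≡×ℕ : ∀ p q → SameQuadrant p q → ℤ.∣ cross p q ∣ ≡ ∣ p ∣ᵖ ×ℕ ∣ q ∣ᵖ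
∣cross∣≡×ℕ (x , y) (x′ , y′) (sx , sy) = begin
  ℤ.∣ ((ℤ.sign x Sign.* ℤ.sign y′) ℤ.◃ ℤ.∣ x ∣ * ℤ.∣ y′ ∣) ℤ.- ((ℤ.sign y Sign.* ℤ.sign x′) ℤ.◃ ℤ.∣ y ∣ * ℤ.∣ x′ ∣) ∣
    ≡⟨ cong₂ (λ s s′ → ℤ.∣ (s ℤ.◃ ℤ.∣ x ∣ * ℤ.∣ y′ ∣) ℤ.- (s′ ℤ.◃ ℤ.∣ y ∣ * ℤ.∣ x′ ∣) ∣)
         (cong (ℤ.sign x Sign.*_) (sym sy))
         (trans (cong (ℤ.sign y Sign.*_) (sym sx)) (Sign.*-comm (ℤ.sign y) (ℤ.sign x))) ⟩
  ℤ.∣ ((ℤ.sign x Sign.* ℤ.sign y) ℤ.◃ ℤ.∣ x ∣ * ℤ.∣ y′ ∣) ℤ.- ((ℤ.sign x Sign.* ℤ.sign y) ℤ.◃ ℤ.∣ y ∣ * ℤ.∣ x′ ∣) ∣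
    ≡⟨ ∣s◃m-s◃n∣≡∣m-n∣ (ℤ.sign x Sign.* ℤ.sign y) (ℤ.∣ x ∣ * ℤ.∣ y′ ∣) (ℤ.∣ y ∣ * ℤ.∣ x′ ∣) ⟩
  ℕ.∣ ℤ.∣ x ∣ * ℤ.∣ y′ ∣ - ℤ.∣ y ∣ * ℤ.∣ x′ ∣ ∣ ∎
  where open ≡-Reasoning

‖_‖₁ ‖_‖² : ℕ × ℕ → ℕ
‖ a , b ‖₁ = a + b
‖ v ‖² = v ·ℕ v

‖v‖₁≡0⇒v≡0 : ∀ v → ‖ v ‖₁ ≡ 0 → v ≡ (0 , 0)
‖v‖₁≡0⇒v≡0 (zero , zero) _ = refl

‖v‖²≡0⇒v≡0 : ∀ v → ‖ v ‖² ≡ 0 → v ≡ (0 , 0)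
‖v‖²≡0⇒v≡0 (zero , zero) _ = refl

swap-‖‖₁ : ∀ v → ‖ swap v ‖₁ ≡ ‖ v ‖₁
swap-‖‖₁ (a , b) = ℕ.+-comm b a

swap-‖‖² : ∀ v → ‖ swap v ‖² ≡ ‖ v ‖²
swap-‖‖² (a , b) = ℕ.+-comm (b * b) (a * a)

×ℕ-comm : ∀ v w → v ×ℕ w ≡ w ×ℕ v
×ℕ-comm (a , b) (a′ , b′) =
  trans (ℕ.∣-∣-comm (a * b′) (b * a′)) (cong₂ ℕ.∣_-_∣ (ℕ.*-comm b a′) (ℕ.*-comm a b′))

swap-×ℕ : ∀ v w → swap v ×ℕ swap w ≡ v ×ℕ w
swap-×ℕ (a , b) (a′ , b′) = ℕ.∣-∣-comm (b * a′) (a * b′)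

2*m*n≤m*m+n*n : ∀ m n → 2 * (m * n) ≤ m * m + n * n
2*m*n≤m*m+n*n m n = [ ordered , reversed ]′ (ℕ.≤-total m n)
  where
  ordered : ∀ {m n} → m ≤ n → 2 * (m * n) ≤ m * m + n * n
  ordered {m} m≤n with d , refl ← ℕ.m≤n⇒∃[o]m+o≡n m≤n =
    subst (2 * (m * (m + d)) ≤_) (square-of-sum m d) (ℕ.m≤m+n (2 * (m * (m + d))) (d * d))
    where
    square-of-sum : ∀ m d → 2 * (m * (m + d)) + d * d ≡ m * m + (m + d) * (m + d)
    square-of-sum = solve-∀
  reversed : n ≤ m → 2 * (m * n) ≤ m * m + n * n
  reversed n≤m = subst₂ _≤_ (cong (2 *_) (ℕ.*-comm n m)) (ℕ.+-comm (n * n) (m * m)) (ordered n≤m)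

2*·ℕ≤‖‖²+‖‖² : ∀ v w → 2 * (v ·ℕ w) ≤ ‖ v ‖² + ‖ w ‖²
2*·ℕ≤‖‖²+‖‖² (a , b) (a′ , b′) = begin
  2 * (a * a′ + b * b′)                           ≡⟨ ℕ.*-distribˡ-+ 2 (a * a′) (b * b′) ⟩
  2 * (a * a′) + 2 * (b * b′)                     ≤⟨ ℕ.+-mono-≤ (2*m*n≤m*m+n*n a a′) (2*m*n≤m*m+n*n b b′) ⟩
  (a * a + a′ * a′) + (b * b + b′ * b′)           ≡⟨ regroup a a′ b b′ ⟩
  (a * a + b * b) + (a′ * a′ + b′ * b′)           ∎
  where
  open ℕ.≤-Reasoning
  regroup : ∀ a a′ b b′ → (a * a + a′ * a′) + (b * b + b′ * b′) ≡ (a * a + b * b) + (a′ * a′ + b′ * b′)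
  regroup = solve-∀

·ℕ≤‖‖² : ∀ v w → ‖ v ‖² ≤ ‖ w ‖² → v ·ℕ w ≤ ‖ w ‖²
·ℕ≤‖‖² v w ‖v‖≤‖w‖ = ℕ.*-cancelˡ-≤ 2 (begin
  2 * (v ·ℕ w)         ≤⟨ 2*·ℕ≤‖‖²+‖‖² v w ⟩
  ‖ v ‖² + ‖ w ‖²      ≤⟨ ℕ.+-monoˡ-≤ ‖ w ‖² ‖v‖≤‖w‖ ⟩
  ‖ w ‖² + ‖ w ‖²      ≡⟨ cong (_+_ ‖ w ‖²) (ℕ.+-identityʳ ‖ w ‖²) ⟨
  2 * ‖ w ‖²           ∎)
  where open ℕ.≤-Reasoning

‖‖₁²≤2*‖‖² : ∀ v → ‖ v ‖₁ * ‖ v ‖₁ ≤ 2 * ‖ v ‖²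
‖‖₁²≤2*‖‖² (a , b) = begin
  (a + b) * (a + b)               ≡⟨ expand a b ⟩
  (a * a + b * b) + 2 * (a * b)   ≤⟨ ℕ.+-monoʳ-≤ (a * a + b * b) (2*m*n≤m*m+n*n a b) ⟩
  (a * a + b * b) + (a * a + b * b) ≡⟨ cong (_+_ (a * a + b * b)) (ℕ.+-identityʳ (a * a + b * b)) ⟨
  2 * (a * a + b * b)             ∎
  where
  open ℕ.≤-Reasoning
  expand : ∀ a b → (a + b) * (a + b) ≡ (a * a + b * b) + 2 * (a * b)
  expand = solve-∀

-- Counting vectors that are far from parallel

∣m-n∣≡∣o-p∣ : ∀ m n o p → m + p ≡ n + o → ℕ.∣ m - n ∣ ≡ ℕ.∣ o - p ∣
∣m-n∣≡∣o-p∣ m n o p m+p≡n+o = begin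
  ℕ.∣ m - n ∣         ≡⟨ ℕ.∣m+n-m+o∣≡∣n-o∣ p m n ⟨
  ℕ.∣ p + m - p + n ∣ ≡⟨ cong₂ ℕ.∣_-_∣ (trans (ℕ.+-comm p m) m+p≡n+o) (ℕ.+-comm p n) ⟩
  ℕ.∣ n + o - n + p ∣ ≡⟨ ℕ.∣m+n-m+o∣≡∣n-o∣ n o p ⟩
  ℕ.∣ o - p ∣         ∎
  where open ≡-Reasoning

-- ⌊K a / (a + b)⌋ is the index of the slice of width 1 / K of [0, 1] containing a / (a + b).
same-slice⇒×ℕ< : ∀ K v w .{{_ : NonZero ‖ v ‖₁}} .{{_ : NonZero ‖ w ‖₁}} →
  (K * proj₁ v) / ‖ v ‖₁ ≡ (K * proj₁ w) / ‖ w ‖₁ → K * (v ×ℕ w) < ‖ v ‖₁ * ‖ w ‖₁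
same-slice⇒×ℕ< K v@(a , b) w@(a′ , b′) same = begin-strict
  K * ℕ.∣ a * b′ - b * a′ ∣         ≡⟨ ℕ.*-distribˡ-∣-∣ K (a * b′) (b * a′) ⟩
  ℕ.∣ K * (a * b′) - K * (b * a′) ∣ ≡⟨ ∣m-n∣≡∣o-p∣ (K * (a * b′)) (K * (b * a′)) (r * s′) (r′ * s) balance ⟩
  ℕ.∣ r * s′ - r′ * s ∣             ≤⟨ ℕ.∣m-n∣≤m⊔n (r * s′) (r′ * s) ⟩
  r * s′ ℕ.⊔ r′ * s                 <⟨ ℕ.⊔-lub (ℕ.*-monoˡ-< s′ (m%n<n (K * a) s))
                                              (subst (r′ * s <_) (ℕ.*-comm s′ s) (ℕ.*-monoˡ-< s (m%n<n (K * a′) s′))) ⟩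
  s * s′                            ∎
  where
  open ℕ.≤-Reasoning
  s s′ q r r′ : ℕ
  s = a + b
  s′ = a′ + b′
  q = (K * a) / s
  r = (K * a) % s
  r′ = (K * a′) % s′
  Ka≡r+qs : K * a ≡ r + q * s
  Ka≡r+qs = m≡m%n+[m/n]*n (K * a) s
  Ka′≡r′+qs′ : K * a′ ≡ r′ + q * s′
  Ka′≡r′+qs′ = trans (m≡m%n+[m/n]*n (K * a′) s′) (cong (λ q → r′ + q * s′) (sym same))
  balance : K * (a * b′) + r′ * s ≡ K * (b * a′) + r * s′
  balance = ℕ.+-cancelʳ-≡ (K * a * a′) (K * (a * b′) + r′ * s) (K * (b * a′) + r * s′) (begin-equality
    K * (a * b′) + r′ * s + K * a * a′ ≡⟨ collect-a K a a′ b′ (r′ * s) ⟩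
    K * a * s′ + r′ * s                ≡⟨ cong (λ x → x * s′ + r′ * s) Ka≡r+qs ⟩
    (r + q * s) * s′ + r′ * s          ≡⟨ exchange r r′ q s s′ ⟩
    (r′ + q * s′) * s + r * s′         ≡⟨ cong (λ x → x * s + r * s′) Ka′≡r′+qs′ ⟨
    K * a′ * s + r * s′                ≡⟨ collect-a′ K a a′ b (r * s′) ⟩
    K * (b * a′) + r * s′ + K * a * a′ ∎)
    where
    collect-a : ∀ K a a′ b′ X → K * (a * b′) + X + K * a * a′ ≡ K * a * (a′ + b′) + X
    collect-a = solve-∀
    exchange : ∀ r r′ q s s′ → (r + q * s) * s′ + r′ * s ≡ (r′ + q * s′) * s + r * s′
    exchange = solve-∀
    collect-a′ : ∀ K a a′ b X → K * a′ * (a + b) + X ≡ K * (b * a′) + X + K * a * a′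
    collect-a′ = solve-∀

dyadic-shell : ∀ s .{{_ : NonZero s}} → ∃[ j ] 2 ^ j ≤ s × s < 2 ^ suc j
dyadic-shell (suc zero) = 0 , ℕ.≤-refl , s≤s (s≤s z≤n)
dyadic-shell (suc (suc s)) with dyadic-shell (suc s)
... | j , lo , hi with suc (suc s) ℕ.<? 2 ^ suc j
...   | yes below = j , ℕ.m≤n⇒m≤1+n lo , below
...   | no ¬below = suc j , ℕ.≮⇒≥ ¬below , ℕ.≤-<-trans hi (ℕ.^-monoʳ-< 2 (s≤s (s≤s z≤n)) (ℕ.n<1+n (suc j)))

m*m≤n*n⇒m≤n : ∀ {m n} → m * m ≤ n * n → m ≤ n
m*m≤n*n⇒m≤n m²≤n² = ℕ.≮⇒≥ (λ n<m → ℕ.<⇒≱ (ℕ.*-mono-< n<m n<m) m²≤n²)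

-- √x + √y ≤ (a + b)√z from √x ≤ a√z and √y ≤ b√z, squared to avoid square roots.
sum-of-square-roots : ∀ x y z a b → x * x ≤ a * a * z → y * y ≤ b * b * z →
  (x + y) * (x + y) ≤ (a + b) * (a + b) * z
sum-of-square-roots x y z a b x²≤ y²≤ = begin
  (x + y) * (x + y)                     ≡⟨ expand x y ⟩
  x * x + 2 * (x * y) + y * y           ≤⟨ ℕ.+-mono-≤ (ℕ.+-mono-≤ x²≤ (ℕ.*-monoʳ-≤ 2 xy≤abz)) y²≤ ⟩
  a * a * z + 2 * (a * b * z) + b * b * z ≡⟨ collect a b z ⟩
  (a + b) * (a + b) * z                 ∎
  where
  open ℕ.≤-Reasoning
  expand : ∀ x y → (x + y) * (x + y) ≡ x * x + 2 * (x * y) + y * y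
  expand = solve-∀
  collect : ∀ a b z → a * a * z + 2 * (a * b * z) + b * b * z ≡ (a + b) * (a + b) * z
  collect = solve-∀
  square-product : ∀ p q → p * p * (q * q) ≡ (p * q) * (p * q)
  square-product = solve-∀
  xy≤abz : x * y ≤ a * b * z
  xy≤abz = m*m≤n*n⇒m≤n (begin
    (x * y) * (x * y)             ≡⟨ square-product x y ⟨
    x * x * (y * y)               ≤⟨ ℕ.*-mono-≤ x²≤ y²≤ ⟩
    a * a * z * (b * b * z)       ≡⟨ rearrange a b z ⟩
    (a * b * z) * (a * b * z)     ∎)
    where
    rearrange : ∀ a b z → a * a * z * (b * b * z) ≡ (a * b * z) * (a * b * z)
    rearrange = solve-∀

-- The shell 2 ^ j ≤ ‖ v ‖₁ < 2 ^ (j + 1) of vectors with first coordinate at most m is cut into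
-- sectors m j sectors; the cells of all shells below j are numbered 0, …, cells m j − 1.
sectors : ℕ → ℕ → ℕ
sectors m j = 12 * (2 ^ j ⊓ m) + 1

cells : ℕ → ℕ → ℕ
cells m zero    = 0
cells m (suc j) = cells m j + sectors m j

cells-mono-≤ : ∀ m {j j′} → j ≤ j′ → cells m j ≤ cells m j′
cells-mono-≤ m {j′ = zero}  z≤n = ℕ.≤-refl
cells-mono-≤ m {j} {suc j′} j≤1+j′ with ℕ.m≤n⇒m<n∨m≡n j≤1+j′
... | inj₂ refl         = ℕ.≤-refl
... | inj₁ (s≤s j≤j′)   = ℕ.≤-trans (cells-mono-≤ m j≤j′) (ℕ.m≤m+n (cells m j′) (sectors m j′))

cell<cells-suc : ∀ m j {f} → f < sectors m j → cells m j + f < cells m (suc j)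
cell<cells-suc m j f<s = ℕ.+-monoʳ-< (cells m j) f<s

cell-<-higher-shell : ∀ m {j j′ f} f′ → j < j′ → f < sectors m j → cells m j + f < cells m j′ + f′
cell-<-higher-shell m {j} {j′} f′ j<j′ f<s = ℕ.<-≤-trans (cell<cells-suc m j f<s)
  (ℕ.≤-trans (cells-mono-≤ m j<j′) (ℕ.m≤m+n (cells m j′) f′))

cell-injectiveˡ : ∀ m {j j′ f f′} → f < sectors m j → f′ < sectors m j′ →
  cells m j + f ≡ cells m j′ + f′ → j ≡ j′
cell-injectiveˡ m {j} {j′} {f} {f′} f<s f′<s eq with ℕ.<-cmp j j′
... | tri≈ _ j≡j′ _ = j≡j′
... | tri< j<j′ _ _ = contradiction eq (ℕ.<⇒≢ (cell-<-higher-shell m f′ j<j′ f<s))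
... | tri> _ _ j′<j = contradiction (sym eq) (ℕ.<⇒≢ (cell-<-higher-shell m f j′<j f′<s))

sectors≤13*[2^j⊓1+m] : ∀ m j → sectors m j ≤ 13 * (2 ^ j ⊓ suc m)
sectors≤13*[2^j⊓1+m] m j = begin
  12 * (2 ^ j ⊓ m) + 1                ≤⟨ ℕ.+-mono-≤ (ℕ.*-monoʳ-≤ 12 (ℕ.⊓-monoʳ-≤ (2 ^ j) (ℕ.n≤1+n m)))
                                                    (ℕ.⊓-glb (ℕ.m^n>0 2 j) (s≤s z≤n)) ⟩
  12 * (2 ^ j ⊓ suc m) + 2 ^ j ⊓ suc m ≡⟨ thirteen (2 ^ j ⊓ suc m) ⟩
  13 * (2 ^ j ⊓ suc m)                ∎
  where
  open ℕ.≤-Reasoning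
  thirteen : ∀ t → 12 * t + t ≡ 13 * t
  thirteen = solve-∀

sectors²≤169*[1+m]*2^j : ∀ m j → sectors m j * sectors m j ≤ 13 * 13 * (suc m * 2 ^ j)
sectors²≤169*[1+m]*2^j m j = begin
  sectors m j * sectors m j     ≤⟨ ℕ.*-mono-≤ (sectors≤13*[2^j⊓1+m] m j) (sectors≤13*[2^j⊓1+m] m j) ⟩
  (13 * t) * (13 * t)           ≡⟨ regroup t ⟩
  13 * 13 * (t * t)             ≤⟨ ℕ.*-monoʳ-≤ (13 * 13) (ℕ.*-mono-≤ (ℕ.m⊓n≤n (2 ^ j) (suc m)) (ℕ.m⊓n≤m (2 ^ j) (suc m))) ⟩
  13 * 13 * (suc m * 2 ^ j)     ∎
  where
  open ℕ.≤-Reasoning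
  t : ℕ
  t = 2 ^ j ⊓ suc m
  regroup : ∀ t → (13 * t) * (13 * t) ≡ 13 * 13 * (t * t)
  regroup = solve-∀

-- Since 1024 = 32², 169 = 13² and (32 + 13)² ≤ 2 · 1024, the bound survives the doubling of 2 ^ j.
cells²≤1024*[1+m]*2^j : ∀ m j → cells m j * cells m j ≤ 1024 * (suc m * 2 ^ j)
cells²≤1024*[1+m]*2^j m zero    = z≤n
cells²≤1024*[1+m]*2^j m (suc j) = begin
  (cells m j + sectors m j) * (cells m j + sectors m j)
    ≤⟨ sum-of-square-roots (cells m j) (sectors m j) (suc m * 2 ^ j) 32 13
         (cells²≤1024*[1+m]*2^j m j) (sectors²≤169*[1+m]*2^j m j) ⟩
  45 * 45 * (suc m * 2 ^ j)   ≤⟨ ℕ.*-monoˡ-≤ (suc m * 2 ^ j) (ℕ.m≤m+n 2025 23) ⟩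
  2048 * (suc m * 2 ^ j)      ≡⟨ double (suc m) (2 ^ j) ⟩
  1024 * (suc m * 2 ^ suc j)  ∎
  where
  open ℕ.≤-Reasoning
  double : ∀ M p → 2048 * (M * p) ≡ 1024 * (M * (2 * p))
  double = solve-∀

*-≤-⊓ : ∀ {R c m s} → c ≤ m → c ≤ s → R ≤ s → R * c ≤ (R ⊓ m) * s
*-≤-⊓ {R} {c} {m} {s} c≤m c≤s R≤s with ℕ.≤-total R m
... | inj₁ R≤m rewrite ℕ.m≤n⇒m⊓n≡m R≤m = ℕ.*-monoʳ-≤ R c≤s
... | inj₂ m≤R rewrite ℕ.m≥n⇒m⊓n≡n m≤R = subst (_≤ m * s) (ℕ.*-comm c R) (ℕ.*-mono-≤ c≤m R≤s)

12*R*c<[2R]²⇒8c²<R² : ∀ R c → 12 * R * c < (2 * R) * (2 * R) → 8 * (c * c) < R * R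
12*R*c<[2R]²⇒8c²<R² R c 12Rc<4R² = begin-strict
  8 * (c * c)        ≤⟨ ℕ.m≤m+n (8 * (c * c)) (c * c) ⟩
  8 * (c * c) + c * c ≡⟨ nine c ⟩
  (3 * c) * (3 * c)  <⟨ ℕ.*-mono-< 3c<R 3c<R ⟩
  R * R              ∎
  where
  open ℕ.≤-Reasoning
  nine : ∀ c → 8 * (c * c) + c * c ≡ (3 * c) * (3 * c)
  nine = solve-∀
  factor₁ : ∀ R c → 12 * R * c ≡ (3 * c) * (4 * R)
  factor₁ = solve-∀
  factor₂ : ∀ R → (2 * R) * (2 * R) ≡ R * (4 * R)
  factor₂ = solve-∀
  3c<R : 3 * c < R
  3c<R = ℕ.*-cancelʳ-< (4 * R) (3 * c) R (subst₂ _<_ (factor₁ R c) (factor₂ R) 12Rc<4R²)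

R≤‖w‖₁⇒R²≤2‖w‖² : ∀ {R} w → R ≤ ‖ w ‖₁ → R * R ≤ 2 * ‖ w ‖²
R≤‖w‖₁⇒R²≤2‖w‖² w R≤‖w‖₁ = ℕ.≤-trans (ℕ.*-mono-≤ R≤‖w‖₁ R≤‖w‖₁) (‖‖₁²≤2*‖‖² w)

module Counting {n L : ℕ} (m : ℕ) (v : Fin n → ℕ × ℕ) (label : Fin n → Fin L)
  (‖v‖₁≢0 : ∀ i → NonZero ‖ v i ‖₁)
  (narrow : ∀ i → proj₁ (v i) ≤ m)
  (separated : ∀ i j → i ≢ j → label i ≡ label j → ‖ v i ‖² ≤ ‖ v j ‖² →
               ‖ v j ‖² ≤ 4 * ((v i ×ℕ v j) * (v i ×ℕ v j)))
  where

  separated-at-scale : ∀ {i j} R → i ≢ j → label i ≡ label j → R ≤ ‖ v i ‖₁ → R ≤ ‖ v j ‖₁ →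
                       R * R ≤ 8 * ((v i ×ℕ v j) * (v i ×ℕ v j))
  separated-at-scale {i} {j} R i≢j same R≤i R≤j =
    subst (R * R ≤_) (eight (c * c)) ([ i-shorter , j-shorter ]′ (ℕ.≤-total (‖ v i ‖²) (‖ v j ‖²)))
    where
    c : ℕ
    c = v i ×ℕ v j
    eight : ∀ x → 2 * (4 * x) ≡ 8 * x
    eight = solve-∀
    i-shorter : ‖ v i ‖² ≤ ‖ v j ‖² → R * R ≤ 2 * (4 * (c * c))
    i-shorter i≤j = ℕ.≤-trans (R≤‖w‖₁⇒R²≤2‖w‖² (v j) R≤j) (ℕ.*-monoʳ-≤ 2 (separated i j i≢j same i≤j))
    j-shorter : ‖ v j ‖² ≤ ‖ v i ‖² → R * R ≤ 2 * (4 * (c * c))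
    j-shorter j≤i = ℕ.≤-trans (R≤‖w‖₁⇒R²≤2‖w‖² (v i) R≤i) (ℕ.*-monoʳ-≤ 2
      (subst (λ c → ‖ v i ‖² ≤ 4 * (c * c)) (×ℕ-comm (v j) (v i)) (separated j i (i≢j ∘ sym) (sym same) j≤i)))

  shell : ∀ i → ∃[ j ] 2 ^ j ≤ ‖ v i ‖₁ × ‖ v i ‖₁ < 2 ^ suc j
  shell i = dyadic-shell ‖ v i ‖₁ {{‖v‖₁≢0 i}}

  scale : Fin n → ℕ
  scale i = proj₁ (shell i)

  R : Fin n → ℕ
  R i = 2 ^ scale i

  R≤‖v‖₁ : ∀ i → R i ≤ ‖ v i ‖₁
  R≤‖v‖₁ i = proj₁ (proj₂ (shell i))

  ‖v‖₁<2R : ∀ i → ‖ v i ‖₁ < 2 * R i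
  ‖v‖₁<2R i = proj₂ (proj₂ (shell i))

  sector : Fin n → ℕ
  sector i = (12 * R i * proj₁ (v i)) / ‖ v i ‖₁
    where
    instance
      ‖vi‖₁≢0 : NonZero ‖ v i ‖₁
      ‖vi‖₁≢0 = ‖v‖₁≢0 i

  sector<sectors : ∀ i → sector i < sectors m (scale i)
  sector<sectors i = m<n*o⇒m/o<n (begin-strict
    12 * R i * c               ≡⟨ ℕ.*-assoc 12 (R i) c ⟩
    12 * (R i * c)             ≤⟨ ℕ.*-monoʳ-≤ 12 (*-≤-⊓ (narrow i) (ℕ.m≤m+n c e) (R≤‖v‖₁ i)) ⟩
    12 * ((R i ⊓ m) * s)       <⟨ ℕ.m<m+n (12 * ((R i ⊓ m) * s)) (ℕ.>-nonZero⁻¹ s) ⟩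
    12 * ((R i ⊓ m) * s) + s   ≡⟨ distrib (R i ⊓ m) s ⟩
    sectors m (scale i) * s    ∎)
    where
    open ℕ.≤-Reasoning
    instance
      ‖vi‖₁≢0 : NonZero ‖ v i ‖₁
      ‖vi‖₁≢0 = ‖v‖₁≢0 i
    c e s : ℕ
    c = proj₁ (v i)
    e = proj₂ (v i)
    s = ‖ v i ‖₁
    distrib : ∀ t s → 12 * (t * s) + s ≡ (12 * t + 1) * s
    distrib = solve-∀

  cell : Fin n → ℕ
  cell i = cells m (scale i) + sector i

  cell-injective : ∀ {i j} → label i ≡ label j → cell i ≡ cell j → i ≡ j
  cell-injective {i} {j} same cell≡ = decidable-stable (i Fin.≟ j) distinct-cells
    where
    instance
      ‖vi‖₁≢0 : NonZero ‖ v i ‖₁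
      ‖vi‖₁≢0 = ‖v‖₁≢0 i
      ‖vj‖₁≢0 : NonZero ‖ v j ‖₁
      ‖vj‖₁≢0 = ‖v‖₁≢0 j
    scale≡ : scale i ≡ scale j
    scale≡ = cell-injectiveˡ m (sector<sectors i) (sector<sectors j) cell≡
    R≡ : R i ≡ R j
    R≡ = cong (2 ^_) scale≡
    sector≡ : (12 * R i * proj₁ (v i)) / ‖ v i ‖₁ ≡ (12 * R i * proj₁ (v j)) / ‖ v j ‖₁
    sector≡ = trans (ℕ.+-cancelˡ-≡ (cells m (scale i)) (sector i) (sector j)
                      (trans cell≡ (cong (λ k → cells m k + sector j) (sym scale≡))))
                    (cong (λ r → (12 * r * proj₁ (v j)) / ‖ v j ‖₁) (sym R≡))
    distinct-cells : i ≢ j → ⊥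
    distinct-cells i≢j = ℕ.<⇒≱ (12*R*c<[2R]²⇒8c²<R² (R i) (v i ×ℕ v j) (begin-strict
        12 * R i * (v i ×ℕ v j)    <⟨ same-slice⇒×ℕ< (12 * R i) (v i) (v j) sector≡ ⟩
        ‖ v i ‖₁ * ‖ v j ‖₁        <⟨ ℕ.*-mono-< (‖v‖₁<2R i) (subst (λ r → ‖ v j ‖₁ < 2 * r) (sym R≡) (‖v‖₁<2R j)) ⟩
        (2 * R i) * (2 * R i)      ∎))
      (separated-at-scale (R i) i≢j same (R≤‖v‖₁ i) (subst (_≤ ‖ v j ‖₁) (sym R≡) (R≤‖v‖₁ j)))
      where open ℕ.≤-Reasoning

  count : ∀ J → (∀ i → ‖ v i ‖₁ < 2 ^ suc J) → n ≤ L * cells m (suc J)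
  count J ‖v‖₁<2^[1+J] = Fin.injective⇒≤ code-injective
    where
    scale≤J : ∀ i → scale i ≤ J
    scale≤J i = ℕ.≮⇒≥ (λ J<scale → ℕ.<⇒≱ (‖v‖₁<2^[1+J] i) (ℕ.≤-trans (ℕ.^-monoʳ-≤ 2 J<scale) (R≤‖v‖₁ i)))
    cell< : ∀ i → cell i < cells m (suc J)
    cell< i = ℕ.<-≤-trans (cell<cells-suc m (scale i) (sector<sectors i)) (cells-mono-≤ m (s≤s (scale≤J i)))
    code : Fin n → Fin (L * cells m (suc J))
    code i = Fin.combine (label i) (Fin.fromℕ< (cell< i))
    code-injective : ∀ {i j} → code i ≡ code j → i ≡ j
    code-injective {i} {j} eq =
      let same , eq′ = Fin.combine-injective (label i) (Fin.fromℕ< (cell< i)) (label j) (Fin.fromℕ< (cell< j)) eq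
      in cell-injective same (Fin.fromℕ<-injective (cell i) (cell j) (cell< i) (cell< j) eq′)

-- Star drawings

SideLength⇒∣-∣≤ : ∀ {n} {f : Fin n → ℤ} {L} → SideLength f L → ∀ i j → ℤ.∣ f i ℤ.- f j ∣ ≤ L
SideLength⇒∣-∣≤ {f = f} {L} (lo , hi , bounds , hi-lo≡L) i j =
  [ spread i j , (λ fj≤fi → subst (_≤ L) (ℤ.∣i-j∣≡∣j-i∣ (f j) (f i)) (spread j i fj≤fi)) ]′ (ℤ.≤-total (f i) (f j))
  where
  spread : ∀ i j → f i ℤ.≤ f j → ℤ.∣ f i ℤ.- f j ∣ ≤ L
  spread i j fi≤fj = ℤ.drop‿+≤+ (begin
    + ℤ.∣ f i ℤ.- f j ∣ ≡⟨ ℤ.∣-∣-≤ fi≤fj ⟩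
    f j ℤ.- f i         ≤⟨ ℤ.+-mono-≤ (proj₂ (bounds j)) (ℤ.neg-mono-≤ (proj₁ (bounds i))) ⟩
    f hi ℤ.- f lo       ≡⟨ hi-lo≡L ⟩
    + L                 ∎)
    where open ℤ.≤-Reasoning

[1+m]*[1+Lx+Ly]≤2*[1+Lx]*[1+Ly] : ∀ {m Lx Ly} → m ≤ Lx → m ≤ Ly → suc m * suc (Lx + Ly) ≤ 2 * (suc Lx * suc Ly)
[1+m]*[1+Lx+Ly]≤2*[1+Lx]*[1+Ly] {m} {Lx} {Ly} m≤Lx m≤Ly = begin
  suc m * (suc Lx + Ly)             ≡⟨ ℕ.*-distribˡ-+ (suc m) (suc Lx) Ly ⟩
  suc m * suc Lx + suc m * Ly       ≤⟨ ℕ.+-mono-≤ (ℕ.*-monoˡ-≤ (suc Lx) (s≤s m≤Ly))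
                                                  (ℕ.≤-trans (ℕ.*-monoˡ-≤ Ly (s≤s m≤Lx)) (ℕ.*-monoʳ-≤ (suc Lx) (ℕ.n≤1+n Ly))) ⟩
  suc Ly * suc Lx + suc Lx * suc Ly ≡⟨ twice (suc Lx) (suc Ly) ⟩
  2 * (suc Lx * suc Ly)             ∎
  where
  open ℕ.≤-Reasoning
  twice : ∀ x y → y * x + x * y ≡ 2 * (x * y)
  twice = solve-∀

quadratic-bound : ∀ {n m Lx Ly} J → m ≤ Lx → m ≤ Ly → 2 ^ J ≤ suc (Lx + Ly) → n ≤ 4 * cells m (suc J) →
  suc n * suc n ≤ 102400 * (suc Lx * suc Ly)
quadratic-bound {n} {m} {Lx} {Ly} J m≤Lx m≤Ly 2^J≤ n≤4S = begin
  suc n * suc n                                      ≤⟨ ℕ.*-mono-≤ 1+n≤5S 1+n≤5S ⟩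
  (5 * S) * (5 * S)                                  ≡⟨ square-of-five S ⟩
  25 * (S * S)                                       ≤⟨ ℕ.*-monoʳ-≤ 25 (cells²≤1024*[1+m]*2^j m (suc J)) ⟩
  25 * (1024 * (suc m * 2 ^ suc J))                  ≡⟨ cong (λ x → 25 * (1024 * x)) (shift (suc m) (2 ^ J)) ⟩
  25 * (1024 * (2 * (suc m * 2 ^ J)))                ≤⟨ ℕ.*-monoʳ-≤ 25 (ℕ.*-monoʳ-≤ 1024 (ℕ.*-monoʳ-≤ 2
                                                          (ℕ.≤-trans (ℕ.*-monoʳ-≤ (suc m) 2^J≤) ([1+m]*[1+Lx+Ly]≤2*[1+Lx]*[1+Ly] m≤Lx m≤Ly)))) ⟩
  25 * (1024 * (2 * (2 * (suc Lx * suc Ly))))        ≡⟨ constants (suc Lx * suc Ly) ⟩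
  102400 * (suc Lx * suc Ly)                         ∎
  where
  open ℕ.≤-Reasoning
  S : ℕ
  S = cells m (suc J)
  1≤S : 1 ≤ S
  1≤S = ℕ.≤-trans (ℕ.m≤n+m 1 (12 * (2 ^ J ⊓ m))) (ℕ.m≤n+m (sectors m J) (cells m J))
  1+n≤5S : suc n ≤ 5 * S
  1+n≤5S = ℕ.+-mono-≤ 1≤S n≤4S
  square-of-five : ∀ S → (5 * S) * (5 * S) ≡ 25 * (S * S)
  square-of-five = solve-∀
  shift : ∀ M p → M * (2 * p) ≡ 2 * (M * p)
  shift = solve-∀
  constants : ∀ A → 25 * (1024 * (2 * (2 * A))) ≡ 102400 * A
  constants = solve-∀

module StarDrawing {n : ℕ} (D : DiskLinkDrawing (Star (suc n))) where
  open DiskLinkDrawing D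

  spoke : Fin (suc n) → Pointℤ
  spoke i = pos i -ᵖ pos Fin.zero

  spoke≢0 : ∀ {i} → i ≢ Fin.zero → ∣ spoke i ∣ᵖ ≢ (0 , 0)
  spoke≢0 {i} i≢0 ∣spoke∣≡0 =
    distinct i Fin.zero i≢0 (cong₂ _,_ (coordinate≡ (cong proj₁ ∣spoke∣≡0)) (coordinate≡ (cong proj₂ ∣spoke∣≡0)))
    where
    coordinate≡ : ∀ {x x′} → ℤ.∣ x ℤ.- x′ ∣ ≡ 0 → x ≡ x′
    coordinate≡ {x} {x′} eq = ℤ.i-j≡0⇒i≡j x x′ (ℤ.∣i∣≡0⇒i≡0 eq)

  spokes-separated : ∀ i j → i ≢ Fin.zero → j ≢ Fin.zero → i ≢ j → quadrant (spoke i) ≡ quadrant (spoke j) →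
    ‖ ∣ spoke i ∣ᵖ ‖² ≤ ‖ ∣ spoke j ∣ᵖ ‖² →
    ‖ ∣ spoke j ∣ᵖ ‖² ≤ 4 * ((∣ spoke i ∣ᵖ ×ℕ ∣ spoke j ∣ᵖ) * (∣ spoke i ∣ᵖ ×ℕ ∣ spoke j ∣ᵖ))
  spokes-separated i j i≢0 j≢0 i≢j same-quadrant i≤j = ℕ.≮⇒≥ λ 4c²<N →
    avoid Fin.zero j i (inj₁ (refl , j≢0 ∘ Fin.toℕ-injective)) i≢0 i≢j
      (segment-hits-disk (pos Fin.zero) (pos j) (pos i) {{N≢0}}
        (dot≡+·ℕ (spoke i) (spoke j) Q) (dot≡+·ℕ (spoke j) (spoke j) (refl , refl))
        (·ℕ≤‖‖² ∣ spoke i ∣ᵖ ∣ spoke j ∣ᵖ i≤j) (subst (ℤ._< + N) (sym 4κ²≡4c²) (ℤ.+<+ 4c²<N)))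
    where
    c N : ℕ
    c = ∣ spoke i ∣ᵖ ×ℕ ∣ spoke j ∣ᵖ
    N = ‖ ∣ spoke j ∣ᵖ ‖²
    Q : SameQuadrant (spoke i) (spoke j)
    Q = quadrant≡⇒SameQuadrant (spoke i) (spoke j) same-quadrant
    N≢0 : NonZero N
    N≢0 = ℕ.≢-nonZero (spoke≢0 j≢0 ∘ ‖v‖²≡0⇒v≡0 ∣ spoke j ∣ᵖ)
    κ : ℤ
    κ = cross (spoke i) (spoke j)
    4κ²≡4c² : + 4 ℤ.* (κ ℤ.* κ) ≡ + (4 * (c * c))
    4κ²≡4c² = begin
      + 4 ℤ.* (κ ℤ.* κ)                ≡⟨ cong (+ 4 ℤ.*_) (i*i≡+∣i∣*∣i∣ κ) ⟩
      + 4 ℤ.* + (ℤ.∣ κ ∣ * ℤ.∣ κ ∣)   ≡⟨ cong (λ x → + 4 ℤ.* + (x * x)) (∣cross∣≡×ℕ (spoke i) (spoke j) Q) ⟩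
      + 4 ℤ.* + (c * c)                ≡⟨ ℤ.pos-* 4 (c * c) ⟨
      + (4 * (c * c))                  ∎
      where open ≡-Reasoning

  leaf : Fin n → ℕ × ℕ
  leaf k = ∣ spoke (Fin.suc k) ∣ᵖ

  leaf-quadrant : Fin n → Fin 4
  leaf-quadrant k = quadrant (spoke (Fin.suc k))

  ‖leaf‖₁≢0 : ∀ k → NonZero ‖ leaf k ‖₁
  ‖leaf‖₁≢0 k = ℕ.≢-nonZero (spoke≢0 (λ ()) ∘ ‖v‖₁≡0⇒v≡0 (leaf k))

  leaves-separated : ∀ k l → k ≢ l → leaf-quadrant k ≡ leaf-quadrant l → ‖ leaf k ‖² ≤ ‖ leaf l ‖² →
                   ‖ leaf l ‖² ≤ 4 * ((leaf k ×ℕ leaf l) * (leaf k ×ℕ leaf l))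
  leaves-separated k l k≢l = spokes-separated (Fin.suc k) (Fin.suc l) (λ ()) (λ ()) (k≢l ∘ Fin.suc-injective)

  ‖swap-leaf‖₁≢0 : ∀ k → NonZero ‖ swap (leaf k) ‖₁
  ‖swap-leaf‖₁≢0 k = subst NonZero (sym (swap-‖‖₁ (leaf k))) (‖leaf‖₁≢0 k)

  swapped-leaves-separated : ∀ k l → k ≢ l → leaf-quadrant k ≡ leaf-quadrant l → ‖ swap (leaf k) ‖² ≤ ‖ swap (leaf l) ‖² →
    ‖ swap (leaf l) ‖² ≤ 4 * ((swap (leaf k) ×ℕ swap (leaf l)) * (swap (leaf k) ×ℕ swap (leaf l)))
  swapped-leaves-separated k l k≢l same k≤l =
    subst₂ _≤_ (sym (swap-‖‖² (leaf l))) (cong (λ c → 4 * (c * c)) (sym (swap-×ℕ (leaf k) (leaf l))))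
      (leaves-separated k l k≢l same (subst₂ _≤_ (swap-‖‖² (leaf k)) (swap-‖‖² (leaf l)) k≤l))

  module _ {Lx Ly : ℕ} (x-side : SideLength (xs pos) Lx) (y-side : SideLength (ys pos) Ly) where

    leaf-x≤Lx : ∀ k → proj₁ (leaf k) ≤ Lx
    leaf-x≤Lx k = SideLength⇒∣-∣≤ x-side (Fin.suc k) Fin.zero

    leaf-y≤Ly : ∀ k → proj₂ (leaf k) ≤ Ly
    leaf-y≤Ly k = SideLength⇒∣-∣≤ y-side (Fin.suc k) Fin.zero

    ‖leaf‖₁≤Lx+Ly : ∀ k → ‖ leaf k ‖₁ ≤ Lx + Ly
    ‖leaf‖₁≤Lx+Ly k = ℕ.+-mono-≤ (leaf-x≤Lx k) (leaf-y≤Ly k)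

    -- The counting runs along the shorter side of the bounding box.
    leaves-count : ∀ J → Lx + Ly < 2 ^ suc J → ∃[ m ] m ≤ Lx × m ≤ Ly × n ≤ 4 * cells m (suc J)
    leaves-count J Lx+Ly<2^[1+J] = [ along-x , along-y ]′ (ℕ.≤-total Lx Ly)
      where
      along-x : Lx ≤ Ly → ∃[ m ] m ≤ Lx × m ≤ Ly × n ≤ 4 * cells m (suc J)
      along-x Lx≤Ly = Lx , ℕ.≤-refl , Lx≤Ly ,
        Counting.count Lx leaf leaf-quadrant ‖leaf‖₁≢0 leaf-x≤Lx leaves-separated J
          (λ k → ℕ.≤-<-trans (‖leaf‖₁≤Lx+Ly k) Lx+Ly<2^[1+J])
      along-y : Ly ≤ Lx → ∃[ m ] m ≤ Lx × m ≤ Ly × n ≤ 4 * cells m (suc J)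
      along-y Ly≤Lx = Ly , Ly≤Lx , ℕ.≤-refl ,
        Counting.count Ly (swap ∘ leaf) leaf-quadrant ‖swap-leaf‖₁≢0 leaf-y≤Ly swapped-leaves-separated J
          (λ k → ℕ.≤-<-trans (subst (_≤ Lx + Ly) (sym (swap-‖‖₁ (leaf k))) (‖leaf‖₁≤Lx+Ly k)) Lx+Ly<2^[1+J])

    grid-bound : suc n * suc n ≤ 102400 * (suc Lx * suc Ly)
    grid-bound =
      let J , 2^J≤ , 1+Lx+Ly<2^[1+J] = dyadic-shell (suc (Lx + Ly))
          m , m≤Lx , m≤Ly , n≤4S = leaves-count J (ℕ.<-trans (ℕ.n<1+n (Lx + Ly)) 1+Lx+Ly<2^[1+J])
      in quadratic-bound J m≤Lx m≤Ly 2^J≤ n≤4S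

1/102400 : ℚ
1/102400 = + 1 ℚ./ 102400

1/102400*X≤Y : ∀ X Y → X ≤ 102400 * Y → 1/102400 ℚ.* toℚ (+ X) ℚ.≤ toℚ (+ Y)
1/102400*X≤Y X Y X≤102400Y = begin
  1/102400 ℚ.* toℚ (+ X)                           ≤⟨ ℚ.*-monoˡ-≤-nonNeg 1/102400 {{ℚ.normalize-nonNeg 1 102400}} (toℚ-mono-≤ (ℤ.+≤+ X≤102400Y)) ⟩
  1/102400 ℚ.* toℚ (+ (102400 * Y))                ≡⟨ cong (1/102400 ℚ.*_) (trans (cong toℚ (ℤ.pos-* 102400 Y)) (toℚ-* (+ 102400) (+ Y))) ⟩
  1/102400 ℚ.* (toℚ (+ 102400) ℚ.* toℚ (+ Y))      ≡⟨ ℚ.*-assoc 1/102400 (toℚ (+ 102400)) (toℚ (+ Y)) ⟨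
  1/102400 ℚ.* toℚ (+ 102400) ℚ.* toℚ (+ Y)        ≡⟨ ℚ.*-identityˡ (toℚ (+ Y)) ⟩
  toℚ (+ Y)                                        ∎
  where open ℚ.≤-Reasoning

theorem7 : Σ ℚ (λ c → (0ℚ ℚ.< c) × ((n : ℕ) → 3 ≤ n → (D : DiskLinkDrawing (Star n)) → (W H : ℕ) → OnGrid D W H → c ℚ.* ((+ (n * n)) ℚ./ 1) ℚ.≤ ((+ (W * H)) ℚ./ 1)))
theorem7 = 1/102400 , ℚ.positive⁻¹ 1/102400 {{ℚ.normalize-pos 1 102400}} , bound
  where
  bound : (n : ℕ) → 3 ≤ n → (D : DiskLinkDrawing (Star n)) → (W H : ℕ) → OnGrid D W H →
          1/102400 ℚ.* toℚ (+ (n * n)) ℚ.≤ toℚ (+ (W * H))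
  -- 3 ≤ n only excludes n = 0.
  bound (suc n) _ D _ _ (Lx , Ly , refl , refl , x-side , y-side) =
    1/102400*X≤Y (suc n * suc n) (suc Lx * suc Ly) (StarDrawing.grid-bound D x-side y-side)
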